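{- $\tilde t(1)=2$.
   Context: Let $\mathfrak{C}=\{0,1\}^n$ be the vertex set of the $n$-dimensional hypercube; $\oplus,\wedge$ denote bitwise XOR and AND. An outmap is any function $s:\mathfrak{C}\to\{0,1\}^n$. A clash of $s$ is a pair of distinct vertices $u,v$ with $(s(u)\oplus s(v))\wedge(u\oplus v)=0^n$. A query at $u$ to the oracle for $s$ returns $s(u)$; algorithms choose queries adaptively, and only the number of queries is counted. \textsc{Sink-or-Clash}: given oracle access to an arbitrary outmap $s$, query either a vertex $u$ with $s(u)=0^n$ or both vertices of some clash. $\tilde t(n)=\min_{\mathcal A}\max_s \mathbb E[\tilde t(\mathcal A,s)]$, where $\mathcal A$ ranges over randomized algorithms solving \textsc{Sink-or-Clash} on all outmaps $s$ of the $n$-cube and $\tilde t(\mathcal A,s)$ is the random number of queries made on $s$. -}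

module Defs where

open import Data.Bool using (Bool; true; false; if_then_else_; _∧_; _xor_)
import Data.Bool.Properties as Bool
open import Data.Integer using (+_)
open import Data.List using (List; []; _∷_; map)
open import Data.List.Relation.Unary.Any using (Any; any?)
open import Data.Maybe using (Maybe; just; nothing)
open import Data.Nat as ℕ using (ℕ; zero; suc)
import Data.Nat.Properties as ℕ
open import Data.Product using (Σ-syntax; ∃-syntax; _×_; _,_)
open import Data.Rational as ℚ using (ℚ; 0ℚ; 1ℚ; ½; ∣_∣)
import Data.Rational.Properties as ℚ
open import Data.Rational.Solver using (module +-*-Solver)
open import Data.Sum using (_⊎_)
open import Data.Vec as Vec using (Vec; zipWith; replicate)
open import Data.Vec.Properties using (≡-dec)
open import Relation.Binary.PropositionalEquality
  using (_≡_; _≢_; refl; sym; trans; cong; subst)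
open import Relation.Nullary using (Dec; does; ¬?; _×-dec_; _⊎-dec_)

------------------------------------------------------------------------
-- Real numbers: Cauchy sequences of rationals (with a modulus).

IsCauchy : (ℕ → ℚ) → Set
IsCauchy x = ∀ ε → 0ℚ ℚ.< ε →
  ∃[ N ] (∀ m n → N ℕ.≤ m → N ℕ.≤ n → ∣ x m ℚ.- x n ∣ ℚ.≤ ε)

record ℝ : Set where
  constructor mkℝ
  field
    seq    : ℕ → ℚ
    cauchy : IsCauchy seq

open ℝ public

infix  4 _≤_ _≈_
infixl 6 _+_
infixl 7 _*_

_≤_ : ℝ → ℝ → Set
x ≤ y = ∀ ε → 0ℚ ℚ.< ε →
  ∃[ N ] (∀ n → N ℕ.≤ n → seq x n ℚ.≤ seq y n ℚ.+ ε)

_≈_ : ℝ → ℝ → Set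
x ≈ y = x ≤ y × y ≤ x

private
  half-pos : ∀ {ε} → 0ℚ ℚ.< ε → 0ℚ ℚ.< ½ ℚ.* ε
  half-pos 0<ε = ℚ.*-monoʳ-<-pos ½ 0<ε

  halves : ∀ ε → ½ ℚ.* ε ℚ.+ ½ ℚ.* ε ≡ ε
  halves ε = trans (sym (ℚ.*-distribʳ-+ ε ½ ½)) (ℚ.*-identityˡ ε)

  telescope : ∀ a b c → (a ℚ.- b) ℚ.+ (b ℚ.- c) ≡ a ℚ.- c
  telescope = solve 3 (λ a b c → (a :- b) :+ (b :- c) := a :- c) refl
    where open +-*-Solver

  +-cauchy : ∀ {x y} → IsCauchy x → IsCauchy y → IsCauchy (λ n → x n ℚ.+ y n)
  +-cauchy {x} {y} cx cy ε 0<ε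
    with cx (½ ℚ.* ε) (half-pos 0<ε) | cy (½ ℚ.* ε) (half-pos 0<ε)
  ... | M , hx | N , hy = M ℕ.⊔ N , λ m n m≥ n≥ → begin
      ∣ (x m ℚ.+ y m) ℚ.- (x n ℚ.+ y n) ∣
        ≡⟨ cong ∣_∣ (rearrange (x m) (y m) (x n) (y n)) ⟩
      ∣ (x m ℚ.- x n) ℚ.+ (y m ℚ.- y n) ∣
        ≤⟨ ℚ.∣p+q∣≤∣p∣+∣q∣ (x m ℚ.- x n) (y m ℚ.- y n) ⟩
      ∣ x m ℚ.- x n ∣ ℚ.+ ∣ y m ℚ.- y n ∣
        ≤⟨ ℚ.+-mono-≤
             (hx m n (ℕ.m⊔n≤o⇒m≤o M N m≥) (ℕ.m⊔n≤o⇒m≤o M N n≥))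
             (hy m n (ℕ.m⊔n≤o⇒n≤o M N m≥) (ℕ.m⊔n≤o⇒n≤o M N n≥)) ⟩
      ½ ℚ.* ε ℚ.+ ½ ℚ.* ε
        ≡⟨ halves ε ⟩
      ε ∎
    where
    open ℚ.≤-Reasoning
    rearrange : ∀ a b c d →
      (a ℚ.+ b) ℚ.- (c ℚ.+ d) ≡ (a ℚ.- c) ℚ.+ (b ℚ.- d)
    rearrange = solve 4 (λ a b c d →
      (a :+ b) :- (c :+ d) := (a :- c) :+ (b :- d)) refl
      where open +-*-Solver

  EventuallyBounded : (ℕ → ℚ) → Set
  EventuallyBounded x = Σ[ B ∈ ℚ ] (ℚ.Positive B ×
    ∃[ N ] (∀ n → N ℕ.≤ n → ∣ x n ∣ ℚ.≤ B))

  bounded : ∀ {x} → IsCauchy x → EventuallyBounded x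
  bounded {x} cx with cx 1ℚ (ℚ.positive⁻¹ 1ℚ)
  ... | N , h = ∣ x N ∣ ℚ.+ 1ℚ , pos , N , λ n n≥ → begin
      ∣ x n ∣
        ≡⟨ cong ∣_∣ (split (x n) (x N)) ⟩
      ∣ x N ℚ.+ (x n ℚ.- x N) ∣
        ≤⟨ ℚ.∣p+q∣≤∣p∣+∣q∣ (x N) (x n ℚ.- x N) ⟩
      ∣ x N ∣ ℚ.+ ∣ x n ℚ.- x N ∣
        ≤⟨ ℚ.+-monoʳ-≤ ∣ x N ∣ (h n N n≥ ℕ.≤-refl) ⟩
      ∣ x N ∣ ℚ.+ 1ℚ ∎
    where
    open ℚ.≤-Reasoning
    pos : ℚ.Positive (∣ x N ∣ ℚ.+ 1ℚ)
    pos = ℚ.nonNeg+pos⇒pos ∣ x N ∣ {{ℚ.∣-∣-nonNeg (x N)}} 1ℚ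
    split : ∀ a b → a ≡ b ℚ.+ (a ℚ.- b)
    split = solve 2 (λ a b → a := b :+ (a :- b)) refl
      where open +-*-Solver

  rescale : ∀ B → ℚ.Positive B → ∀ ε → 0ℚ ℚ.< ε →
    Σ[ δ ∈ ℚ ] (0ℚ ℚ.< δ × B ℚ.* δ ≡ ε)
  rescale B B>0 ε 0<ε =
    1/B ℚ.* ε , ℚ.positive⁻¹ (1/B ℚ.* ε) {{prod}} ,
    trans (sym (ℚ.*-assoc B 1/B ε))
      (trans (cong (ℚ._* ε) (ℚ.*-inverseʳ B {{B≢0}})) (ℚ.*-identityˡ ε))
    where
    B≢0 = ℚ.pos⇒nonZero B {{B>0}}
    1/B = ℚ.1/_ B {{B≢0}}
    prod : ℚ.Positive (1/B ℚ.* ε)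
    prod = ℚ.pos*pos⇒pos 1/B {{ℚ.1/pos⇒pos B {{B>0}}}} ε {{ℚ.positive 0<ε}}

  *-bound : ∀ p q {B δ} → ℚ.Positive B → ∣ p ∣ ℚ.≤ B → ∣ q ∣ ℚ.≤ δ →
    ∣ p ℚ.* q ∣ ℚ.≤ B ℚ.* δ
  *-bound p q {B} {δ} B>0 p≤B q≤δ = begin
    ∣ p ℚ.* q ∣
      ≡⟨ ℚ.∣p*q∣≡∣p∣*∣q∣ p q ⟩
    ∣ p ∣ ℚ.* ∣ q ∣
      ≤⟨ ℚ.*-monoʳ-≤-nonNeg ∣ q ∣ {{ℚ.∣-∣-nonNeg q}} p≤B ⟩
    B ℚ.* ∣ q ∣
      ≤⟨ ℚ.*-monoˡ-≤-nonNeg B {{ℚ.pos⇒nonNeg B {{B>0}}}} q≤δ ⟩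
    B ℚ.* δ ∎
    where open ℚ.≤-Reasoning

  factor : ∀ a b c d →
    a ℚ.* b ℚ.- c ℚ.* d ≡ a ℚ.* (b ℚ.- d) ℚ.+ d ℚ.* (a ℚ.- c)
  factor a b c d = sym (begin-equality
    a ℚ.* (b ℚ.- d) ℚ.+ d ℚ.* (a ℚ.- c)
      ≡⟨ cong (ℚ._+ d ℚ.* (a ℚ.- c)) (ℚ.*-distribˡ-+ a b (ℚ.- d)) ⟩
    (a ℚ.* b ℚ.+ a ℚ.* (ℚ.- d)) ℚ.+ d ℚ.* (a ℚ.- c)
      ≡⟨ cong (λ z → (a ℚ.* b ℚ.+ z) ℚ.+ d ℚ.* (a ℚ.- c))
           (sym (ℚ.neg-distribʳ-* a d)) ⟩
    (a ℚ.* b ℚ.- a ℚ.* d) ℚ.+ d ℚ.* (a ℚ.- c)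
      ≡⟨ cong ((a ℚ.* b ℚ.- a ℚ.* d) ℚ.+_) (ℚ.*-distribˡ-+ d a (ℚ.- c)) ⟩
    (a ℚ.* b ℚ.- a ℚ.* d) ℚ.+ (d ℚ.* a ℚ.+ d ℚ.* (ℚ.- c))
      ≡⟨ cong (λ z → (a ℚ.* b ℚ.- a ℚ.* d) ℚ.+ (z ℚ.+ d ℚ.* (ℚ.- c)))
           (ℚ.*-comm d a) ⟩
    (a ℚ.* b ℚ.- a ℚ.* d) ℚ.+ (a ℚ.* d ℚ.+ d ℚ.* (ℚ.- c))
      ≡⟨ cong (λ z → (a ℚ.* b ℚ.- a ℚ.* d) ℚ.+ (a ℚ.* d ℚ.+ z))
           (trans (sym (ℚ.neg-distribʳ-* d c)) (cong ℚ.-_ (ℚ.*-comm d c))) ⟩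
    (a ℚ.* b ℚ.- a ℚ.* d) ℚ.+ (a ℚ.* d ℚ.- c ℚ.* d)
      ≡⟨ telescope (a ℚ.* b) (a ℚ.* d) (c ℚ.* d) ⟩
    a ℚ.* b ℚ.- c ℚ.* d ∎)
    where open ℚ.≤-Reasoning

  *-close : ∀ a b c d {B C β γ ε} → ℚ.Positive B → ℚ.Positive C →
    B ℚ.* β ≡ ½ ℚ.* ε → C ℚ.* γ ≡ ½ ℚ.* ε →
    ∣ a ∣ ℚ.≤ B → ∣ b ℚ.- d ∣ ℚ.≤ β → ∣ d ∣ ℚ.≤ C → ∣ a ℚ.- c ∣ ℚ.≤ γ →
    ∣ a ℚ.* b ℚ.- c ℚ.* d ∣ ℚ.≤ ε
  *-close a b c d {B} {C} {β} {γ} {ε} B>0 C>0 Bβ Cγ a≤ b-d≤ d≤ a-c≤ = begin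
    ∣ a ℚ.* b ℚ.- c ℚ.* d ∣
      ≡⟨ cong ∣_∣ (factor a b c d) ⟩
    ∣ a ℚ.* (b ℚ.- d) ℚ.+ d ℚ.* (a ℚ.- c) ∣
      ≤⟨ ℚ.∣p+q∣≤∣p∣+∣q∣ (a ℚ.* (b ℚ.- d)) (d ℚ.* (a ℚ.- c)) ⟩
    ∣ a ℚ.* (b ℚ.- d) ∣ ℚ.+ ∣ d ℚ.* (a ℚ.- c) ∣
      ≤⟨ ℚ.+-mono-≤ (*-bound a (b ℚ.- d) B>0 a≤ b-d≤)
                    (*-bound d (a ℚ.- c) C>0 d≤ a-c≤) ⟩
    B ℚ.* β ℚ.+ C ℚ.* γ
      ≡⟨ cong (ℚ._+ C ℚ.* γ) Bβ ⟩
    ½ ℚ.* ε ℚ.+ C ℚ.* γ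
      ≡⟨ cong (½ ℚ.* ε ℚ.+_) Cγ ⟩
    ½ ℚ.* ε ℚ.+ ½ ℚ.* ε
      ≡⟨ halves ε ⟩
    ε ∎
    where open ℚ.≤-Reasoning

  *-cauchy : ∀ {x y} → IsCauchy x → IsCauchy y → IsCauchy (λ n → x n ℚ.* y n)
  *-cauchy {x} {y} cx cy ε 0<ε =
    let B , B>0 , K , hB = bounded {x} cx
        C , C>0 , L , hC = bounded {y} cy
        β , β>0 , Bβ = rescale B B>0 (½ ℚ.* ε) (half-pos 0<ε)
        γ , γ>0 , Cγ = rescale C C>0 (½ ℚ.* ε) (half-pos 0<ε)
        M , hx = cx γ γ>0
        N , hy = cy β β>0
        KL = K ℕ.⊔ L
        MN = M ℕ.⊔ N
    in KL ℕ.⊔ MN , λ m n m≥ n≥ →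
      let KL≤m = ℕ.m⊔n≤o⇒m≤o KL MN m≥
          KL≤n = ℕ.m⊔n≤o⇒m≤o KL MN n≥
          MN≤m = ℕ.m⊔n≤o⇒n≤o KL MN m≥
          MN≤n = ℕ.m⊔n≤o⇒n≤o KL MN n≥
      in *-close (x m) (y m) (x n) (y n) B>0 C>0 Bβ Cγ
           (hB m (ℕ.m⊔n≤o⇒m≤o K L KL≤m))
           (hy m n (ℕ.m⊔n≤o⇒n≤o M N MN≤m) (ℕ.m⊔n≤o⇒n≤o M N MN≤n))
           (hC n (ℕ.m⊔n≤o⇒n≤o K L KL≤n))
           (hx m n (ℕ.m⊔n≤o⇒m≤o M N MN≤m) (ℕ.m⊔n≤o⇒m≤o M N MN≤n))

  const-cauchy : ∀ q → IsCauchy (λ _ → q)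
  const-cauchy q ε 0<ε = 0 , λ _ _ _ _ →
    subst (ℚ._≤ ε) (cong ∣_∣ (sym (ℚ.+-inverseʳ q))) (ℚ.<⇒≤ 0<ε)

fromℚ : ℚ → ℝ
fromℚ q = mkℝ (λ _ → q) (const-cauchy q)

fromℕ : ℕ → ℝ
fromℕ k = fromℚ (+ k ℚ./ 1)

_+_ : ℝ → ℝ → ℝ
x + y = mkℝ (λ n → seq x n ℚ.+ seq y n) (+-cauchy {seq x} {seq y} (cauchy x) (cauchy y))

_*_ : ℝ → ℝ → ℝ
x * y = mkℝ (λ n → seq x n ℚ.* seq y n) (*-cauchy {seq x} {seq y} (cauchy x) (cauchy y))

IsSup : {I : Set} → (I → ℝ) → ℝ → Set
IsSup f c = (∀ i → f i ≤ c) × (∀ b → (∀ i → f i ≤ b) → c ≤ b)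

partialSum : (ℕ → ℝ) → ℕ → ℝ
partialSum a zero    = fromℕ 0
partialSum a (suc K) = partialSum a K + a K

-- Only used for series with nonnegative terms, whose sum is the supremum of
-- the partial sums.
_SumsTo_ : (ℕ → ℝ) → ℝ → Set
a SumsTo l = IsSup (partialSum a) l

------------------------------------------------------------------------
-- The cube, outmaps and clashes.

Vertex : ℕ → Set
Vertex n = Vec Bool n

𝟎 : ∀ {n} → Vertex n
𝟎 = replicate _ false

infixl 6 _⊕_
infixl 7 _⊓_

_⊕_ : ∀ {n} → Vertex n → Vertex n → Vertex n
_⊕_ = zipWith _xor_

_⊓_ : ∀ {n} → Vertex n → Vertex n → Vertex n
_⊓_ = zipWith _∧_

Outmap : ℕ → Set
Outmap n = Vertex n → Vertex n

IsSink : ∀ {n} → Outmap n → Vertex n → Set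
IsSink s u = s u ≡ 𝟎

Clash : ∀ {n} → Outmap n → Vertex n → Vertex n → Set
Clash s u v = u ≢ v × (s u ⊕ s v) ⊓ (u ⊕ v) ≡ 𝟎

Solved : ∀ {n} → Outmap n → List (Vertex n) → Set
Solved s us = Any (IsSink s) us ⊎ Any (λ u → Any (Clash s u) us) us

_≟_ : ∀ {n} (u v : Vertex n) → Dec (u ≡ v)
_≟_ = ≡-dec Bool._≟_

solved? : ∀ {n} (s : Outmap n) us → Dec (Solved s us)
solved? s us =
  any? (λ u → s u ≟ 𝟎) us
  ⊎-dec
  any? (λ u → any? (λ v → ¬? (u ≟ v) ×-dec ((s u ⊕ s v) ⊓ (u ⊕ v)) ≟ 𝟎) us) us

sumCube : ∀ n → (Vertex n → ℝ) → ℝ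
sumCube zero    f = f Vec.[]
sumCube (suc n) f = sumCube n (λ u → f (false Vec.∷ u))
                  + sumCube n (λ u → f (true  Vec.∷ u))

------------------------------------------------------------------------
-- Randomized query algorithms.

-- An algorithm either queries a vertex (`just u`) or halts (`nothing`).
Action : ℕ → Set
Action n = Maybe (Vertex n)

record Distribution (n : ℕ) : Set where
  field
    prob        : Action n → ℝ
    nonNegative : ∀ a → fromℕ 0 ≤ prob a
    total       : prob nothing + sumCube n (λ u → prob (just u)) ≈ fromℕ 1

open Distribution public

-- Queries made so far with their answers, most recent first.
History : ℕ → Set
History n = List (Vertex n × Vertex n)

-- The next action is drawn afresh from a distribution depending on everything
-- seen so far.  As the history is never forgotten, this realises the same
-- laws of runs as a probability measure on deterministic algorithms.
-- Repeated queries and runs that never halt are permitted.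
Algorithm : ℕ → Set
Algorithm n = History n → Distribution n

history : ∀ {n} → Outmap n → List (Vertex n) → History n
history s = map (λ u → u , s u)

-- Probability that, continuing after the queries us, the algorithm makes
-- exactly k more queries, halts, and its final list of queries satisfies E.
haltProb : ∀ {n} → Algorithm n → Outmap n → (E : List (Vertex n) → Bool) →
           List (Vertex n) → ℕ → ℝ
haltProb A s E us zero =
  if E us then prob (A (history s us)) nothing else fromℕ 0
haltProb {n} A s E us (suc k) =
  sumCube n λ u → prob (A (history s us)) (just u) * haltProb A s E (u ∷ us) k

-- Pr[ the algorithm halts after exactly k queries ]
haltsAfter : ∀ {n} → Algorithm n → Outmap n → ℕ → ℝ
haltsAfter A s = haltProb A s (λ _ → true) []

-- Pr[ the algorithm halts after exactly k queries, with the instance solved ]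
solvesAfter : ∀ {n} → Algorithm n → Outmap n → ℕ → ℝ
solvesAfter A s = haltProb A s (λ us → does (solved? s us)) []

-- On every outmap the algorithm halts with the instance solved almost surely.
SolvesSinkOrClash : ∀ {n} → Algorithm n → Set
SolvesSinkOrClash A = ∀ s → solvesAfter A s SumsTo fromℕ 1

-- E[t̃(A , s)] = e
ExpectedQueries : ∀ {n} → Algorithm n → Outmap n → ℝ → Set
ExpectedQueries A s e = (λ k → fromℕ k * haltsAfter A s k) SumsTo e

-- max over s of E[t̃(A , s)] = c.  There are finitely many outmaps, so the
-- maximum is the least upper bound.  No such c exists when some expectation
-- is infinite.
WorstCase : ∀ {n} → Algorithm n → ℝ → Set
WorstCase {n} A c =
  Σ[ e ∈ (Outmap n → ℝ) ] ((∀ s → ExpectedQueries A s (e s)) × IsSup e c)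

-- t̃(n) = c, with c the minimum of the worst cases
t̃[_]≈_ : ℕ → ℝ → Set
t̃[ n ]≈ c =
  (Σ[ A ∈ Algorithm n ] (SolvesSinkOrClash A × WorstCase A c)) ×
  (∀ (A : Algorithm n) → SolvesSinkOrClash A → ∀ b → WorstCase A b → c ≤ b)

{-# OPTIONS --safe #-}
-- Querying both vertices of the 1-cube always reveals a sink or a clash, so two
-- queries suffice.  On the outmap that is constantly 1 there is no sink, hence
-- a correct algorithm queries both vertices almost surely and makes at least
-- two queries in expectation.
module Submission where

open import Defs

open import Data.Bool using (Bool; true; false; if_then_else_)
open import Data.Integer as ℤ using (+_)
import Data.Integer.Properties as ℤ
open import Data.List using (List; []; _∷_)
open import Data.List.Relation.Unary.Any using (here; there)
open import Data.Maybe using (just; nothing)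
open import Data.Nat as ℕ using (ℕ; zero; suc)
import Data.Nat.Properties as ℕ
open import Data.Product using (Σ-syntax; ∃-syntax; _×_; _,_; proj₂)
open import Data.Rational as ℚ using (ℚ; 0ℚ; 1ℚ; ½; ∣_∣)
import Data.Rational.Properties as ℚ
open import Data.Rational.Solver using (module +-*-Solver)
open import Data.Rational.Unnormalised as ℚᵘ using (mkℚᵘ)
import Data.Rational.Unnormalised.Properties as ℚᵘ
open import Data.Sum using (inj₁; inj₂)
open import Data.Vec using ([]; _∷_)
open import Relation.Binary.PropositionalEquality
  using (_≡_; _≢_; refl; sym; trans; cong; cong₂; subst; module ≡-Reasoning)
open import Relation.Nullary using (does; yes; no; contradiction)
open import Relation.Nullary.Decidable using (dec-true)

-- Rational preliminaries

p≤∣p∣ : ∀ p → p ℚ.≤ ∣ p ∣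
p≤∣p∣ p with ℚ.≤-total p 0ℚ
... | inj₁ p≤0 = ℚ.≤-trans p≤0 (ℚ.0≤∣p∣ p)
... | inj₂ 0≤p = ℚ.≤-reflexive (sym (ℚ.0≤p⇒∣p∣≡p 0≤p))

-- `ℚ._/_` normalises its fraction, which blocks computation for a variable numerator. In the
-- unnormalised rationals both sides have denominator 1, and cross-multiplication reduces the claim
-- to integers.
/1-mono-≤ : ∀ {m n} → m ℕ.≤ n → + m ℚ./ 1 ℚ.≤ + n ℚ./ 1
/1-mono-≤ {m} {n} m≤n = ℚ.toℚᵘ-cancel-≤ (begin
  ℚ.toℚᵘ (+ m ℚ./ 1)  ≃⟨ ℚ.toℚᵘ-fromℚᵘ (mkℚᵘ (+ m) 0) ⟩
  mkℚᵘ (+ m) 0        ≤⟨ ℚᵘ.*≤* (ℤ.*-monoʳ-≤-nonNeg (+ 1) (ℤ.+≤+ m≤n)) ⟩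
  mkℚᵘ (+ n) 0        ≃⟨ ℚ.toℚᵘ-fromℚᵘ (mkℚᵘ (+ n) 0) ⟨
  ℚ.toℚᵘ (+ n ℚ./ 1)  ∎)
  where open ℚᵘ.≤-Reasoning

-- Order and arithmetic of real numbers

-- Lemmas on ≗ and ≤ are applied with explicit endpoints throughout: ≗ and ≤
-- only mention seq, so the Cauchy proofs in the endpoints cannot be inferred.
infix 4 _≗_

_≗_ : ℝ → ℝ → Set
x ≗ y = ∀ m → seq x m ≡ seq y m

≗-sym : ∀ {x y} → x ≗ y → y ≗ x
≗-sym x≗y m = sym (x≗y m)

≗-trans : ∀ {x y z} → x ≗ y → y ≗ z → x ≗ z
≗-trans x≗y y≗z m = trans (x≗y m) (y≗z m)

*-congˡ : ∀ x {y y′} → y ≗ y′ → x * y ≗ x * y′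
*-congˡ x p m = cong (seq x m ℚ.*_) (p m)

+-identityˡ : ∀ x → fromℕ 0 + x ≗ x
+-identityˡ x m = ℚ.+-identityˡ (seq x m)

*-identityˡ : ∀ x → fromℕ 1 * x ≗ x
*-identityˡ x m = ℚ.*-identityˡ (seq x m)

*-identityʳ : ∀ x → x * fromℕ 1 ≗ x
*-identityʳ x m = ℚ.*-identityʳ (seq x m)

*-zeroˡ : ∀ x → fromℕ 0 * x ≗ fromℕ 0
*-zeroˡ x m = ℚ.*-zeroˡ (seq x m)

*-zeroʳ : ∀ x → x * fromℕ 0 ≗ fromℕ 0
*-zeroʳ x m = ℚ.*-zeroʳ (seq x m)

*-comm : ∀ x y → x * y ≗ y * x
*-comm x y m = ℚ.*-comm (seq x m) (seq y m)

pointwise⇒≤ : ∀ {x y} → (∀ m → seq x m ℚ.≤ seq y m) → x ≤ y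
pointwise⇒≤ {x} {y} x≤y ε 0<ε = 0 , λ m _ →
  ℚ.≤-trans (x≤y m)
    (subst (ℚ._≤ seq y m ℚ.+ ε) (ℚ.+-identityʳ (seq y m))
      (ℚ.+-monoʳ-≤ (seq y m) (ℚ.<⇒≤ 0<ε)))

≤-reflexive : ∀ {x y} → x ≗ y → x ≤ y
≤-reflexive {x} {y} x≗y = pointwise⇒≤ {x} {y} λ m → ℚ.≤-reflexive (x≗y m)

≤-refl : ∀ {x} → x ≤ x
≤-refl {x} = ≤-reflexive {x} {x} λ _ → refl

½*-pos : ∀ {ε} → 0ℚ ℚ.< ε → 0ℚ ℚ.< ½ ℚ.* ε
½*-pos = ℚ.*-monoʳ-<-pos ½

½*+½* : ∀ ε → ½ ℚ.* ε ℚ.+ ½ ℚ.* ε ≡ ε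
½*+½* ε = trans (sym (ℚ.*-distribʳ-+ ε ½ ½)) (ℚ.*-identityˡ ε)

≤-trans : ∀ {x y z} → x ≤ y → y ≤ z → x ≤ z
≤-trans {x} {y} {z} x≤y y≤z ε 0<ε
  with x≤y (½ ℚ.* ε) (½*-pos 0<ε) | y≤z (½ ℚ.* ε) (½*-pos 0<ε)
... | M , f | N , g = M ℕ.⊔ N , λ m m≥ → begin
  seq x m
    ≤⟨ f m (ℕ.m⊔n≤o⇒m≤o M N m≥) ⟩
  seq y m ℚ.+ ½ ℚ.* ε
    ≤⟨ ℚ.+-monoˡ-≤ (½ ℚ.* ε) (g m (ℕ.m⊔n≤o⇒n≤o M N m≥)) ⟩
  seq z m ℚ.+ ½ ℚ.* ε ℚ.+ ½ ℚ.* ε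
    ≡⟨ ℚ.+-assoc (seq z m) _ _ ⟩
  seq z m ℚ.+ (½ ℚ.* ε ℚ.+ ½ ℚ.* ε)
    ≡⟨ cong (seq z m ℚ.+_) (½*+½* ε) ⟩
  seq z m ℚ.+ ε ∎
  where open ℚ.≤-Reasoning

≤-resp-≗ : ∀ {x x′ y y′} → x ≗ x′ → y ≗ y′ → x ≤ y → x′ ≤ y′
≤-resp-≗ {x} {x′} {y} {y′} p q x≤y =
  ≤-trans {x′} {x} {y′} (≤-reflexive {x′} {x} (≗-sym {x} {x′} p))
    (≤-trans {x} {y} {y′} x≤y (≤-reflexive {y} {y′} q))

+-mono-≤ : ∀ {x x′ y y′} → x ≤ x′ → y ≤ y′ → x + y ≤ x′ + y′
+-mono-≤ {x} {x′} {y} {y′} p q ε 0<ε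
  with p (½ ℚ.* ε) (½*-pos 0<ε) | q (½ ℚ.* ε) (½*-pos 0<ε)
... | M , f | N , g = M ℕ.⊔ N , λ m m≥ → begin
  seq x m ℚ.+ seq y m
    ≤⟨ ℚ.+-mono-≤ (f m (ℕ.m⊔n≤o⇒m≤o M N m≥)) (g m (ℕ.m⊔n≤o⇒n≤o M N m≥)) ⟩
  (seq x′ m ℚ.+ ½ ℚ.* ε) ℚ.+ (seq y′ m ℚ.+ ½ ℚ.* ε)
    ≡⟨ interchange (seq x′ m) (seq y′ m) (½ ℚ.* ε) ⟩
  (seq x′ m ℚ.+ seq y′ m) ℚ.+ (½ ℚ.* ε ℚ.+ ½ ℚ.* ε)
    ≡⟨ cong (seq x′ m ℚ.+ seq y′ m ℚ.+_) (½*+½* ε) ⟩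
  (seq x′ m ℚ.+ seq y′ m) ℚ.+ ε ∎
  where
  open ℚ.≤-Reasoning
  interchange : ∀ a b c → (a ℚ.+ c) ℚ.+ (b ℚ.+ c) ≡ (a ℚ.+ b) ℚ.+ (c ℚ.+ c)
  interchange = solve 3 (λ a b c →
    (a :+ c) :+ (b :+ c) := (a :+ b) :+ (c :+ c)) refl
    where open +-*-Solver

-- Beyond the Cauchy index for tolerance 1, every term is within 1 of `seq x N`. Taking `∣ c ∣`
-- instead of `c` makes the bound nonnegative, as `small-error` requires.
bounded-above : ∀ x → Σ[ B ∈ ℚ ] (0ℚ ℚ.≤ B ×
  ∃[ N ] (∀ m → N ℕ.≤ m → seq x m ℚ.≤ B))
bounded-above x with cauchy x 1ℚ (ℚ.positive⁻¹ 1ℚ)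
... | N , close = ∣ c ∣ ℚ.+ 1ℚ
  , ℚ.+-mono-≤ (ℚ.0≤∣p∣ c) (ℚ.nonNegative⁻¹ 1ℚ)
  , N , λ m m≥ → begin
    seq x m                  ≡⟨ split (seq x m) c ⟩
    c ℚ.+ (seq x m ℚ.- c)    ≤⟨ ℚ.+-mono-≤ (p≤∣p∣ c) (p≤∣p∣ (seq x m ℚ.- c)) ⟩
    ∣ c ∣ ℚ.+ ∣ seq x m ℚ.- c ∣
                             ≤⟨ ℚ.+-monoʳ-≤ ∣ c ∣ (close m N m≥ ℕ.≤-refl) ⟩
    ∣ c ∣ ℚ.+ 1ℚ             ∎
  where
  open ℚ.≤-Reasoning
  c = seq x N
  split : ∀ a b → a ≡ b ℚ.+ (a ℚ.- b)
  split = solve 2 (λ a b → a := b :+ (a :- b)) refl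
    where open +-*-Solver

rescale : ∀ D → ℚ.Positive D → ∀ ε → 0ℚ ℚ.< ε →
  Σ[ δ ∈ ℚ ] (0ℚ ℚ.< δ × δ ℚ.* D ≡ ε)
rescale D D>0 ε 0<ε = ε ℚ.* 1/D , ℚ.positive⁻¹ (ε ℚ.* 1/D) {{prod}} ,
  trans (ℚ.*-assoc ε 1/D D)
    (trans (cong (ε ℚ.*_) (ℚ.*-inverseˡ D {{D≢0}})) (ℚ.*-identityʳ ε))
  where
  D≢0 = ℚ.pos⇒nonZero D {{D>0}}
  1/D = ℚ.1/_ D {{D≢0}}
  prod : ℚ.Positive (ε ℚ.* 1/D)
  prod = ℚ.pos*pos⇒pos ε {{ℚ.positive 0<ε}} 1/D {{ℚ.1/pos⇒pos D {{D>0}}}}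

-- The choice is `δ = ε / D` with `D = B + (1 + ε)`. Since `ε ≤ D`, this `δ` is at most 1, so
-- `B + δ ≤ D` and the product is at most `δ * D = ε`.
small-error : ∀ {B} → 0ℚ ℚ.≤ B → ∀ ε → 0ℚ ℚ.< ε →
  Σ[ δ ∈ ℚ ] (0ℚ ℚ.< δ × δ ℚ.* (B ℚ.+ δ) ℚ.≤ ε)
small-error {B} 0≤B ε 0<ε =
  let δ , 0<δ , δD≡ε = rescale D D>0 ε 0<ε
      δ≤1 = ℚ.*-cancelʳ-≤-pos D {{D>0}} (begin
        δ ℚ.* D   ≡⟨ δD≡ε ⟩
        ε         ≤⟨ ε≤D ⟩
        D         ≡⟨ ℚ.*-identityˡ D ⟨
        1ℚ ℚ.* D  ∎)
  in δ , 0<δ , (begin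
    δ ℚ.* (B ℚ.+ δ)
      ≤⟨ ℚ.*-monoˡ-≤-nonNeg δ {{ℚ.nonNegative (ℚ.<⇒≤ 0<δ)}}
           (ℚ.+-monoʳ-≤ B (ℚ.≤-trans δ≤1 1≤1+ε)) ⟩
    δ ℚ.* D
      ≡⟨ δD≡ε ⟩
    ε ∎)
  where
  open ℚ.≤-Reasoning
  D = B ℚ.+ (1ℚ ℚ.+ ε)
  1≤1+ε : 1ℚ ℚ.≤ 1ℚ ℚ.+ ε
  1≤1+ε = subst (ℚ._≤ 1ℚ ℚ.+ ε) (ℚ.+-identityʳ 1ℚ) (ℚ.+-monoʳ-≤ 1ℚ (ℚ.<⇒≤ 0<ε))
  ε≤D : ε ℚ.≤ D
  ε≤D = begin
    ε                  ≡⟨ ℚ.+-identityˡ ε ⟨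
    0ℚ ℚ.+ ε           ≤⟨ ℚ.+-monoˡ-≤ ε (ℚ.nonNegative⁻¹ 1ℚ) ⟩
    1ℚ ℚ.+ ε           ≡⟨ ℚ.+-identityˡ (1ℚ ℚ.+ ε) ⟨
    0ℚ ℚ.+ (1ℚ ℚ.+ ε)  ≤⟨ ℚ.+-monoˡ-≤ (1ℚ ℚ.+ ε) 0≤B ⟩
    D                  ∎
  D>0 : ℚ.Positive D
  D>0 = ℚ.positive (ℚ.<-≤-trans 0<ε ε≤D)

+δ-* : ∀ p q δ →
  (p ℚ.+ δ) ℚ.* (q ℚ.+ δ) ≡ p ℚ.* q ℚ.+ δ ℚ.* (p ℚ.+ q ℚ.+ δ)
+δ-* p q δ = begin
  (p ℚ.+ δ) ℚ.* (q ℚ.+ δ)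
    ≡⟨ ℚ.*-distribˡ-+ (p ℚ.+ δ) q δ ⟩
  (p ℚ.+ δ) ℚ.* q ℚ.+ (p ℚ.+ δ) ℚ.* δ
    ≡⟨ cong₂ ℚ._+_ (ℚ.*-distribʳ-+ q p δ) (ℚ.*-comm (p ℚ.+ δ) δ) ⟩
  (p ℚ.* q ℚ.+ δ ℚ.* q) ℚ.+ δ ℚ.* (p ℚ.+ δ)
    ≡⟨ ℚ.+-assoc (p ℚ.* q) (δ ℚ.* q) (δ ℚ.* (p ℚ.+ δ)) ⟩
  p ℚ.* q ℚ.+ (δ ℚ.* q ℚ.+ δ ℚ.* (p ℚ.+ δ))
    ≡⟨ cong (p ℚ.* q ℚ.+_) (ℚ.*-distribˡ-+ δ q (p ℚ.+ δ)) ⟨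
  p ℚ.* q ℚ.+ δ ℚ.* (q ℚ.+ (p ℚ.+ δ))
    ≡⟨ cong (λ z → p ℚ.* q ℚ.+ δ ℚ.* z)
         (trans (sym (ℚ.+-assoc q p δ)) (cong (ℚ._+ δ) (ℚ.+-comm q p))) ⟩
  p ℚ.* q ℚ.+ δ ℚ.* (p ℚ.+ q ℚ.+ δ) ∎
  where open ≡-Reasoning

-- Both factors may be negative by as much as δ, but
-- 0 ≤ (p + δ)(q + δ) = pq + δ(p + q + δ).
*-nonNeg-approx : ∀ p q {B C δ ε} → 0ℚ ℚ.< δ → δ ℚ.* (B ℚ.+ C ℚ.+ δ) ℚ.≤ ε →
  p ℚ.≤ B → q ℚ.≤ C → 0ℚ ℚ.≤ p ℚ.+ δ → 0ℚ ℚ.≤ q ℚ.+ δ → 0ℚ ℚ.≤ p ℚ.* q ℚ.+ ε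
*-nonNeg-approx p q {B} {C} {δ} {ε} 0<δ small p≤B q≤C 0≤p+δ 0≤q+δ = begin
  0ℚ
    ≡⟨ ℚ.*-zeroˡ (q ℚ.+ δ) ⟨
  0ℚ ℚ.* (q ℚ.+ δ)
    ≤⟨ ℚ.*-monoʳ-≤-nonNeg (q ℚ.+ δ) {{ℚ.nonNegative 0≤q+δ}} 0≤p+δ ⟩
  (p ℚ.+ δ) ℚ.* (q ℚ.+ δ)
    ≡⟨ +δ-* p q δ ⟩
  p ℚ.* q ℚ.+ δ ℚ.* (p ℚ.+ q ℚ.+ δ)
    ≤⟨ ℚ.+-monoʳ-≤ (p ℚ.* q) (ℚ.*-monoˡ-≤-nonNeg δ {{ℚ.nonNegative (ℚ.<⇒≤ 0<δ)}}
         (ℚ.+-monoˡ-≤ δ (ℚ.+-mono-≤ p≤B q≤C))) ⟩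
  p ℚ.* q ℚ.+ δ ℚ.* (B ℚ.+ C ℚ.+ δ)
    ≤⟨ ℚ.+-monoʳ-≤ (p ℚ.* q) small ⟩
  p ℚ.* q ℚ.+ ε ∎
  where open ℚ.≤-Reasoning

-- Eventual upper bounds on both factors are fixed first, because the tolerance `δ` is chosen from
-- them. The index is then large enough for both bounds to apply and for both factors to be at least
-- minus `δ`.
*-nonNeg : ∀ {x y} → fromℕ 0 ≤ x → fromℕ 0 ≤ y → fromℕ 0 ≤ x * y
*-nonNeg {x} {y} 0≤x 0≤y ε 0<ε =
  let B , 0≤B , K , x≤B = bounded-above x
      C , 0≤C , L , y≤C = bounded-above y
      δ , 0<δ , small = small-error (ℚ.+-mono-≤ 0≤B 0≤C) ε 0<ε
      M , f = 0≤x δ 0<δ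
      N , g = 0≤y δ 0<δ
      KL = K ℕ.⊔ L
      MN = M ℕ.⊔ N
  in KL ℕ.⊔ MN , λ m m≥ →
    let KL≤m = ℕ.m⊔n≤o⇒m≤o KL MN m≥
        MN≤m = ℕ.m⊔n≤o⇒n≤o KL MN m≥
    in *-nonNeg-approx (seq x m) (seq y m) 0<δ small
         (x≤B m (ℕ.m⊔n≤o⇒m≤o K L KL≤m)) (y≤C m (ℕ.m⊔n≤o⇒n≤o K L KL≤m))
         (f m (ℕ.m⊔n≤o⇒m≤o M N MN≤m)) (g m (ℕ.m⊔n≤o⇒n≤o M N MN≤m))

-- As a product, negation inherits its Cauchy proof from `_*_`; `seq-neg` recovers the expected
-- sequence.
-_ : ℝ → ℝ
- x = fromℚ (ℚ.- 1ℚ) * x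

seq-neg : ∀ x m → seq (- x) m ≡ ℚ.- seq x m
seq-neg x m = trans (sym (ℚ.neg-distribˡ-* 1ℚ (seq x m)))
                    (cong ℚ.-_ (ℚ.*-identityˡ (seq x m)))

x≤y⇒0≤y-x : ∀ {x y} → x ≤ y → fromℕ 0 ≤ y + - x
x≤y⇒0≤y-x {x} {y} x≤y ε 0<ε with x≤y ε 0<ε
... | N , f = N , λ m m≥ → begin
  0ℚ
    ≡⟨ ℚ.+-inverseʳ (seq x m) ⟨
  seq x m ℚ.- seq x m
    ≤⟨ ℚ.+-monoˡ-≤ (ℚ.- seq x m) (f m m≥) ⟩
  (seq y m ℚ.+ ε) ℚ.- seq x m
    ≡⟨ rearrange (seq x m) (seq y m) ε ⟩
  (seq y m ℚ.- seq x m) ℚ.+ ε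
    ≡⟨ cong (λ z → (seq y m ℚ.+ z) ℚ.+ ε) (seq-neg x m) ⟨
  seq (y + - x) m ℚ.+ ε ∎
  where
  open ℚ.≤-Reasoning
  rearrange : ∀ a b c → (b ℚ.+ c) ℚ.- a ≡ (b ℚ.- a) ℚ.+ c
  rearrange = solve 3 (λ a b c →
    (b :+ c) :- a := (b :- a) :+ c) refl
    where open +-*-Solver

-- The product of the nonnegative reals `x` and `z + - y` is nonnegative; adding `x * y` to it gives
-- `x * z`.
*-monoˡ-≤ : ∀ {x y z} → fromℕ 0 ≤ x → y ≤ z → x * y ≤ x * z
*-monoˡ-≤ {x} {y} {z} 0≤x y≤z =
  ≤-resp-≗ {fromℕ 0 + x * y} {x * y} {x * (z + - y) + x * y} {x * z}
    (+-identityˡ (x * y))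
    (λ m → begin
      seq x m ℚ.* (seq z m ℚ.+ seq (- y) m) ℚ.+ seq x m ℚ.* seq y m
        ≡⟨ ℚ.*-distribˡ-+ (seq x m) (seq z m ℚ.+ seq (- y) m) (seq y m) ⟨
      seq x m ℚ.* ((seq z m ℚ.+ seq (- y) m) ℚ.+ seq y m)
        ≡⟨ cong (λ w → seq x m ℚ.* ((seq z m ℚ.+ w) ℚ.+ seq y m)) (seq-neg y m) ⟩
      seq x m ℚ.* ((seq z m ℚ.- seq y m) ℚ.+ seq y m)
        ≡⟨ cong (seq x m ℚ.*_) (cancel (seq z m) (seq y m)) ⟩
      seq x m ℚ.* seq z m ∎)
    (+-mono-≤ {fromℕ 0} {x * (z + - y)} {x * y} {x * y}
      (*-nonNeg {x} {z + - y} 0≤x (x≤y⇒0≤y-x {y} {z} y≤z))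
      (≤-refl {x * y}))
  where
  open ≡-Reasoning
  cancel : ∀ a b → (a ℚ.- b) ℚ.+ b ≡ a
  cancel = solve 2 (λ a b → (a :- b) :+ b := a) refl
    where open +-*-Solver

fromℚ-mono-≤ : ∀ {p q} → p ℚ.≤ q → fromℚ p ≤ fromℚ q
fromℚ-mono-≤ {p} {q} p≤q = pointwise⇒≤ {fromℚ p} {fromℚ q} λ _ → p≤q

fromℕ-mono-≤ : ∀ {m n} → m ℕ.≤ n → fromℕ m ≤ fromℕ n
fromℕ-mono-≤ m≤n = fromℚ-mono-≤ (/1-mono-≤ m≤n)

-- Series

partialSum-mono : ∀ {a b} → (∀ k → a k ≤ b k) → ∀ K → partialSum a K ≤ partialSum b K
partialSum-mono         a≤b zero    = ≤-refl {fromℕ 0}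
partialSum-mono {a} {b} a≤b (suc K) =
  +-mono-≤ {partialSum a K} {partialSum b K} {a K} {b K}
    (partialSum-mono {a} {b} a≤b K) (a≤b K)

partialSum-*ˡ : ∀ c a K → partialSum (λ k → c * a k) K ≗ c * partialSum a K
partialSum-*ˡ c a zero    = ≗-sym {c * fromℕ 0} {fromℕ 0} (*-zeroʳ c)
partialSum-*ˡ c a (suc K) m =
  trans (cong (ℚ._+ seq (c * a K) m) (partialSum-*ˡ c a K m))
        (sym (ℚ.*-distribˡ-+ (seq c m) (seq (partialSum a K) m) (seq (a K) m)))

module _ {a : ℕ → ℝ} (j : ℕ) {q : ℚ} (0≤q : 0ℚ ℚ.≤ q)
         (at-j : a j ≗ fromℚ q) (elsewhere : ∀ k → k ≢ j → a k ≗ fromℕ 0) where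

  partialSum-before : ∀ K → K ℕ.≤ j → partialSum a K ≗ fromℕ 0
  partialSum-before zero    _   m = refl
  partialSum-before (suc K) K<j m =
    cong₂ ℚ._+_ (partialSum-before K (ℕ.<⇒≤ K<j) m) (elsewhere K (ℕ.<⇒≢ K<j) m)

  partialSum-after : ∀ K → j ℕ.< K → partialSum a K ≗ fromℚ q
  partialSum-after (suc K) (ℕ.s≤s j≤K) m with K ℕ.≟ j
  ... | yes refl = trans (cong₂ ℚ._+_ (partialSum-before K ℕ.≤-refl m) (at-j m))
                         (ℚ.+-identityˡ q)
  ... | no K≢j   = trans (cong₂ ℚ._+_
                           (partialSum-after K (ℕ.≤∧≢⇒< j≤K (λ eq → K≢j (sym eq))) m)
                           (elsewhere K K≢j m))
                         (ℚ.+-identityʳ q)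

  -- The partial sums are 0 up to index `j` and `q` from `suc j` on, because `partialSum a K` stops
  -- before the term `a K`. The supremum is therefore attained at `suc j`, which gives leastness.
  single-term-SumsTo : a SumsTo fromℚ q
  single-term-SumsTo = upper , λ b ub →
    ≤-resp-≗ {partialSum a (suc j)} {fromℚ q} {b} {b}
      (partialSum-after (suc j) ℕ.≤-refl) (λ _ → refl) (ub (suc j))
    where
    upper : ∀ K → partialSum a K ≤ fromℚ q
    upper K with K ℕ.≤? j
    ... | yes K≤j = ≤-trans {partialSum a K} {fromℕ 0} {fromℚ q}
                      (≤-reflexive {partialSum a K} {fromℕ 0} (partialSum-before K K≤j))
                      (fromℚ-mono-≤ 0≤q)
    ... | no  K≰j = ≤-reflexive {partialSum a K} {fromℚ q}
                      (partialSum-after K (ℕ.≰⇒> K≰j))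

-- Sums over the cube and point masses

sumCube-cong : ∀ n {f g : Vertex n → ℝ} → (∀ u → f u ≗ g u) → sumCube n f ≗ sumCube n g
sumCube-cong zero    f≗g m = f≗g [] m
sumCube-cong (suc n) f≗g m = cong₂ ℚ._+_
  (sumCube-cong n (λ u → f≗g (false ∷ u)) m)
  (sumCube-cong n (λ u → f≗g (true  ∷ u)) m)

sumCube-mono : ∀ n {f g : Vertex n → ℝ} → (∀ u → f u ≤ g u) → sumCube n f ≤ sumCube n g
sumCube-mono zero            f≤g = f≤g []
sumCube-mono (suc n) {f} {g} f≤g =
  +-mono-≤ {sumCube n (λ u → f (false ∷ u))} {sumCube n (λ u → g (false ∷ u))}
           {sumCube n (λ u → f (true  ∷ u))} {sumCube n (λ u → g (true  ∷ u))}
    (sumCube-mono n (λ u → f≤g (false ∷ u)))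
    (sumCube-mono n (λ u → f≤g (true  ∷ u)))

sumCube-zero : ∀ n → sumCube n (λ _ → fromℕ 0) ≗ fromℕ 0
sumCube-zero zero    m = refl
sumCube-zero (suc n) m = cong₂ ℚ._+_ (sumCube-zero n m) (sumCube-zero n m)

sumCube-nonNeg : ∀ n {f : Vertex n → ℝ} → (∀ u → fromℕ 0 ≤ f u) → fromℕ 0 ≤ sumCube n f
sumCube-nonNeg n {f} 0≤f =
  ≤-resp-≗ {sumCube n (λ _ → fromℕ 0)} {fromℕ 0} {sumCube n f} {sumCube n f}
    (sumCube-zero n) (λ _ → refl) (sumCube-mono n 0≤f)

-- Recursion on the coordinates, rather than a test for equality, follows the recursion of
-- `sumCube`, so each half of a sum either vanishes or is an instance of the smaller cube.
kronecker : ∀ {n} → Vertex n → Vertex n → ℝ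
kronecker []          []          = fromℕ 1
kronecker (false ∷ u) (false ∷ v) = kronecker u v
kronecker (false ∷ _) (true  ∷ _) = fromℕ 0
kronecker (true  ∷ _) (false ∷ _) = fromℕ 0
kronecker (true  ∷ u) (true  ∷ v) = kronecker u v

kronecker-nonNeg : ∀ {n} (u v : Vertex n) → fromℕ 0 ≤ kronecker u v
kronecker-nonNeg []          []          = fromℕ-mono-≤ {0} {1} ℕ.z≤n
kronecker-nonNeg (false ∷ u) (false ∷ v) = kronecker-nonNeg u v
kronecker-nonNeg (false ∷ _) (true  ∷ _) = ≤-refl {fromℕ 0}
kronecker-nonNeg (true  ∷ _) (false ∷ _) = ≤-refl {fromℕ 0}
kronecker-nonNeg (true  ∷ u) (true  ∷ v) = kronecker-nonNeg u v

-- The steps by (λ _ _ → refl) cannot be left to conversion: it would compare the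
-- Cauchy proofs of the products, whose normal forms are huge.
sumCube-kronecker : ∀ n (u : Vertex n) (f : Vertex n → ℝ) →
  sumCube n (λ v → kronecker u v * f v) ≗ f u
sumCube-kronecker zero [] f = *-identityˡ (f [])
sumCube-kronecker (suc n) (false ∷ u) f m = begin
  seq (sumCube n (λ v → kronecker (false ∷ u) (false ∷ v) * f (false ∷ v))) m ℚ.+
  seq (sumCube n (λ v → kronecker (false ∷ u) (true ∷ v) * f (true ∷ v))) m
    ≡⟨ cong₂ ℚ._+_
         (sumCube-cong n {λ v → kronecker (false ∷ u) (false ∷ v) * f (false ∷ v)}
           {λ v → kronecker u v * f (false ∷ v)} (λ _ _ → refl) m)
         (sumCube-cong n {λ v → kronecker (false ∷ u) (true ∷ v) * f (true ∷ v)}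
           {λ _ → fromℕ 0} (λ v → *-zeroˡ (f (true ∷ v))) m) ⟩
  seq (sumCube n (λ v → kronecker u v * f (false ∷ v))) m ℚ.+
  seq (sumCube n (λ _ → fromℕ 0)) m
    ≡⟨ cong₂ ℚ._+_ (sumCube-kronecker n u (λ v → f (false ∷ v)) m) (sumCube-zero n m) ⟩
  seq (f (false ∷ u)) m ℚ.+ 0ℚ
    ≡⟨ ℚ.+-identityʳ (seq (f (false ∷ u)) m) ⟩
  seq (f (false ∷ u)) m ∎
  where open ≡-Reasoning
sumCube-kronecker (suc n) (true ∷ u) f m = begin
  seq (sumCube n (λ v → kronecker (true ∷ u) (false ∷ v) * f (false ∷ v))) m ℚ.+
  seq (sumCube n (λ v → kronecker (true ∷ u) (true ∷ v) * f (true ∷ v))) m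
    ≡⟨ cong₂ ℚ._+_
         (sumCube-cong n {λ v → kronecker (true ∷ u) (false ∷ v) * f (false ∷ v)}
           {λ _ → fromℕ 0} (λ v → *-zeroˡ (f (false ∷ v))) m)
         (sumCube-cong n {λ v → kronecker (true ∷ u) (true ∷ v) * f (true ∷ v)}
           {λ v → kronecker u v * f (true ∷ v)} (λ _ _ → refl) m) ⟩
  seq (sumCube n (λ _ → fromℕ 0)) m ℚ.+
  seq (sumCube n (λ v → kronecker u v * f (true ∷ v))) m
    ≡⟨ cong₂ ℚ._+_ (sumCube-zero n m) (sumCube-kronecker n u (λ v → f (true ∷ v)) m) ⟩
  0ℚ ℚ.+ seq (f (true ∷ u)) m
    ≡⟨ ℚ.+-identityˡ (seq (f (true ∷ u)) m) ⟩
  seq (f (true ∷ u)) m ∎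
  where open ≡-Reasoning

≗⇒≈ : ∀ {x y} → x ≗ y → x ≈ y
≗⇒≈ {x} {y} x≗y = ≤-reflexive {x} {y} x≗y , ≤-reflexive {y} {x} (≗-sym {x} {y} x≗y)

-- Distributions concentrated on one action

haltWeight : ∀ {n} → Action n → ℝ
haltWeight nothing  = fromℕ 1
haltWeight (just _) = fromℕ 0

queryWeight : ∀ {n} → Vertex n → Action n → ℝ
queryWeight u nothing  = fromℕ 0
queryWeight u (just v) = kronecker u v

halt : ∀ {n} → Distribution n
halt {n} = record
  { prob        = haltWeight
  ; nonNegative = λ { nothing → fromℕ-mono-≤ {0} {1} ℕ.z≤n ; (just _) → ≤-refl {fromℕ 0} }
  ; total       = ≗⇒≈ {fromℕ 1 + sumCube n (λ _ → fromℕ 0)} {fromℕ 1}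
      λ m → cong (1ℚ ℚ.+_) (sumCube-zero n m)
  }

query : ∀ {n} → Vertex n → Distribution n
query {n} u = record
  { prob        = queryWeight u
  ; nonNegative = λ { nothing → ≤-refl {fromℕ 0} ; (just v) → kronecker-nonNeg u v }
  ; total       = ≗⇒≈ {fromℕ 0 + sumCube n (λ v → queryWeight u (just v))} {fromℕ 1} total-query
  }
  where
  open ≡-Reasoning
  total-query : fromℕ 0 + sumCube n (λ v → queryWeight u (just v)) ≗ fromℕ 1
  total-query m = begin
    0ℚ ℚ.+ seq (sumCube n (λ v → queryWeight u (just v))) m
      ≡⟨ ℚ.+-identityˡ (seq (sumCube n (λ v → queryWeight u (just v))) m) ⟩
    seq (sumCube n (λ v → queryWeight u (just v))) m
      ≡⟨ sumCube-cong n {λ v → queryWeight u (just v)} {λ v → kronecker u v * fromℕ 1}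
           (λ v m → sym (*-identityʳ (kronecker u v) m)) m ⟩
    seq (sumCube n (λ v → kronecker u v * fromℕ 1)) m
      ≡⟨ sumCube-kronecker n u (λ _ → fromℕ 1) m ⟩
    1ℚ ∎

-- The equalities hold between representing sequences, which is stronger than `≈`; they can be
-- substituted under sums and products without any estimate.
record Queries {n} (d : Distribution n) (u : Vertex n) : Set where
  field
    never-halts  : prob d nothing ≗ fromℕ 0
    point-weight : ∀ v → prob d (just v) ≗ kronecker u v

open Queries

Halts : ∀ {n} → Distribution n → Set
Halts d = ∀ v → prob d (just v) ≗ fromℕ 0

-- The left side has the shape of `haltProb` at a successor, so a step that surely queries `u` just
-- continues from `u`.
average-query : ∀ {n} {d : Distribution n} {u} → Queries d u → ∀ (h : Vertex n → ℝ) →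
  sumCube n (λ v → prob d (just v) * h v) ≗ h u
average-query {n} {d} {u} q h m = trans
  (sumCube-cong n {λ v → prob d (just v) * h v} {λ v → kronecker u v * h v}
    (λ v m → cong (ℚ._* seq (h v) m) (point-weight q v m)) m)
  (sumCube-kronecker n u h m)

average-halt : ∀ {n} {d : Distribution n} → Halts d → ∀ (h : Vertex n → ℝ) →
  sumCube n (λ v → prob d (just v) * h v) ≗ fromℕ 0
average-halt {n} {d} halts h m = trans
  (sumCube-cong n {λ v → prob d (just v) * h v} {λ _ → fromℕ 0}
    (λ v m → trans (cong (ℚ._* seq (h v) m) (halts v m)) (*-zeroˡ (h v) m)) m)
  (sumCube-zero n m)

-- Halting probabilities

module _ {n} (A : Algorithm n) (s : Outmap n) where

  haltProb-nonNeg : ∀ E us k → fromℕ 0 ≤ haltProb A s E us k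
  haltProb-nonNeg E us zero with E us
  ... | true  = nonNegative (A (history s us)) nothing
  ... | false = ≤-refl {fromℕ 0}
  haltProb-nonNeg E us (suc k) = sumCube-nonNeg n λ u →
    *-nonNeg {prob (A (history s us)) (just u)} {haltProb A s E (u ∷ us) k}
      (nonNegative (A (history s us)) (just u)) (haltProb-nonNeg E (u ∷ us) k)

  -- Correctness concerns runs that halt with the instance solved, whereas the expected number of
  -- queries counts all halting runs. This inequality passes from the former to the latter.
  haltProb-≤-true : ∀ E us k → haltProb A s E us k ≤ haltProb A s (λ _ → true) us k
  haltProb-≤-true E us zero with E us
  ... | true  = ≤-refl {prob (A (history s us)) nothing}
  ... | false = nonNegative (A (history s us)) nothing
  haltProb-≤-true E us (suc k) = sumCube-mono n λ u →
    *-monoˡ-≤ {prob (A (history s us)) (just u)}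
              {haltProb A s E (u ∷ us) k} {haltProb A s (λ _ → true) (u ∷ us) k}
      (nonNegative (A (history s us)) (just u)) (haltProb-≤-true E (u ∷ us) k)

  module _ (E : List (Vertex n) → Bool) (us : List (Vertex n)) where

    haltProb-query-zero : ∀ {u} → Queries (A (history s us)) u →
      haltProb A s E us 0 ≗ fromℕ 0
    haltProb-query-zero q m with E us
    ... | true  = never-halts q m
    ... | false = refl

    haltProb-query-suc : ∀ {u} → Queries (A (history s us)) u → ∀ k →
      haltProb A s E us (suc k) ≗ haltProb A s E (u ∷ us) k
    haltProb-query-suc q k = average-query {n} {A (history s us)} q (λ v → haltProb A s E (v ∷ us) k)

    haltProb-halt-suc : Halts (A (history s us)) → ∀ k →
      haltProb A s E us (suc k) ≗ fromℕ 0
    haltProb-halt-suc halts k = average-halt {n} {A (history s us)} halts (λ v → haltProb A s E (v ∷ us) k)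

-- The algorithm querying both vertices of the 1-cube

pattern v₀ = false ∷ []
pattern v₁ = true ∷ []

-- Only the length of the history is inspected. The second query is made even if the first vertex is
-- a sink, so the number of queries is 2 on every outmap.
queryBoth : Algorithm 1
queryBoth []          = query v₀
queryBoth (_ ∷ [])    = query v₁
queryBoth (_ ∷ _ ∷ _) = halt

module _ (s : Outmap 1) (E : List (Vertex 1) → Bool) where

  queries-v₀ : Queries (queryBoth (history s [])) v₀
  queries-v₀ = record { never-halts = λ _ → refl ; point-weight = λ _ _ → refl }

  queries-v₁ : Queries (queryBoth (history s (v₀ ∷ []))) v₁
  queries-v₁ = record { never-halts = λ _ → refl ; point-weight = λ _ _ → refl }

  -- With `E` left abstract, one computation serves both the probability of solving and, with `E`
  -- constantly true, the number of queries.
  queryBoth-at-2 : E (v₁ ∷ v₀ ∷ []) ≡ true → haltProb queryBoth s E [] 2 ≗ fromℕ 1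
  queryBoth-at-2 E-holds m = begin
    seq (haltProb queryBoth s E [] 2) m
      ≡⟨ haltProb-query-suc queryBoth s E [] queries-v₀ 1 m ⟩
    seq (haltProb queryBoth s E (v₀ ∷ []) 1) m
      ≡⟨ haltProb-query-suc queryBoth s E (v₀ ∷ []) queries-v₁ 0 m ⟩
    seq (haltProb queryBoth s E (v₁ ∷ v₀ ∷ []) 0) m
      ≡⟨ cong (λ b → seq (if b then fromℕ 1 else fromℕ 0) m) E-holds ⟩
    1ℚ ∎
    where open ≡-Reasoning

  queryBoth-elsewhere : ∀ k → k ≢ 2 → haltProb queryBoth s E [] k ≗ fromℕ 0
  queryBoth-elsewhere 0 _ = haltProb-query-zero queryBoth s E [] queries-v₀
  queryBoth-elsewhere 1 _ m = trans
    (haltProb-query-suc queryBoth s E [] queries-v₀ 0 m)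
    (haltProb-query-zero queryBoth s E (v₀ ∷ []) queries-v₁ m)
  queryBoth-elsewhere 2 2≢2 = contradiction refl 2≢2
  -- After two queries the algorithm is at `halt`, where a third query has weight 0.
  queryBoth-elsewhere (suc (suc (suc k))) _ m = trans
    (haltProb-query-suc queryBoth s E [] queries-v₀ (2 ℕ.+ k) m) (trans
    (haltProb-query-suc queryBoth s E (v₀ ∷ []) queries-v₁ (suc k) m)
    (haltProb-halt-suc queryBoth s E (v₁ ∷ v₀ ∷ []) (λ _ _ → refl) k m))

-- If neither vertex is a sink, both answers are `v₁`; their XOR is then zero and the two vertices
-- clash.
both-solved : ∀ (s : Outmap 1) → Solved s (v₁ ∷ v₀ ∷ [])
both-solved s with s v₁ in eq₁ | s v₀ in eq₀
... | v₀ | _  = inj₁ (here eq₁)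
... | v₁ | v₀ = inj₁ (there (here eq₀))
... | v₁ | v₁ = inj₂ (here (there (here ((λ ()) , clash))))
  where
  clash : (s v₁ ⊕ s v₀) ⊓ (v₁ ⊕ v₀) ≡ 𝟎
  clash rewrite eq₁ | eq₀ = refl

queryBoth-solves : SolvesSinkOrClash queryBoth
queryBoth-solves s = single-term-SumsTo 2 (/1-mono-≤ {0} {1} ℕ.z≤n)
  (queryBoth-at-2 s solved (dec-true (solved? s (v₁ ∷ v₀ ∷ [])) (both-solved s)))
  (queryBoth-elsewhere s solved)
  where solved = λ us → does (solved? s us)

queryBoth-expected : ∀ s → ExpectedQueries queryBoth s (fromℕ 2)
queryBoth-expected s = single-term-SumsTo 2 (/1-mono-≤ {0} {2} ℕ.z≤n)
  (*-congˡ (fromℕ 2) {haltsAfter queryBoth s 2} {fromℕ 1} (queryBoth-at-2 s (λ _ → true) refl))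
  (λ k k≢2 → ≗-trans {fromℕ k * haltsAfter queryBoth s k} {fromℕ k * fromℕ 0} {fromℕ 0}
    (*-congˡ (fromℕ k) {haltsAfter queryBoth s k} {fromℕ 0}
      (queryBoth-elsewhere s (λ _ → true) k k≢2))
    (*-zeroʳ (fromℕ k)))

-- The adversarial outmap

sinkless : Outmap 1
sinkless _ = v₁

module _ (A : Algorithm 1) where

  -- A single queried vertex is no sink and cannot clash with itself. For each of the two vertices
  -- `solved?` computes to false, so both summands are products with 0.
  solvesAfter-1 : solvesAfter A sinkless 1 ≗ fromℕ 0
  solvesAfter-1 m = cong₂ ℚ._+_
    (*-zeroʳ (prob (A []) (just v₀)) m) (*-zeroʳ (prob (A []) (just v₁)) m)

  -- This compares twice the series of solving probabilities with the series of the expectation term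
  -- by term. For `k` below 2 the solving probability is 0; from 2 on the factor `k` is large
  -- enough.
  2*solves≤k*halts : ∀ k →
    fromℕ 2 * solvesAfter A sinkless k ≤ fromℕ k * haltsAfter A sinkless k
  -- No query has been made, so `solved?` is false by computation and both sides are 0.
  2*solves≤k*halts 0 =
    ≤-reflexive {fromℕ 2 * fromℕ 0} {fromℕ 0 * H}
      (≗-sym {fromℕ 0 * H} {fromℕ 0} (*-zeroˡ H))
    where H = haltsAfter A sinkless 0
  2*solves≤k*halts 1 =
    ≤-resp-≗ {fromℕ 0} {fromℕ 2 * S} {fromℕ 1 * H} {fromℕ 1 * H}
      (λ m → sym (cong ((+ 2 ℚ./ 1) ℚ.*_) (solvesAfter-1 m))) (λ _ → refl)
      (*-nonNeg {fromℕ 1} {H} (fromℕ-mono-≤ {0} {1} ℕ.z≤n)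
        (haltProb-nonNeg A sinkless (λ _ → true) [] 1))
    where
    S = solvesAfter A sinkless 1
    H = haltsAfter A sinkless 1
  2*solves≤k*halts k@(suc (suc _)) =
    -- First 2 is raised to `k` with `S` nonnegative, then `S` is raised to `H`.
    ≤-trans {fromℕ 2 * S} {fromℕ k * S} {fromℕ k * H}
      (≤-resp-≗ {S * fromℕ 2} {fromℕ 2 * S} {S * fromℕ k} {fromℕ k * S}
        (*-comm S (fromℕ 2)) (*-comm S (fromℕ k))
        (*-monoˡ-≤ {S} {fromℕ 2} {fromℕ k} (haltProb-nonNeg A sinkless solved [] k)
          (fromℕ-mono-≤ {2} {k} (ℕ.s≤s (ℕ.s≤s ℕ.z≤n)))))
      (*-monoˡ-≤ {fromℕ k} {S} {H} (fromℕ-mono-≤ {0} {k} ℕ.z≤n)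
        (haltProb-≤-true A sinkless solved [] k))
    where
    solved = λ us → does (solved? sinkless us)
    S = solvesAfter A sinkless k
    H = haltsAfter A sinkless k

  -- Correctness says that 1 is the least upper bound of the partial sums `P K`. Since `2 * P K ≤ e`
  -- for all `K`, half of `e` is a competing upper bound; hence `1 ≤ ½ * e`, and doubling finishes.
  2≤expected : SolvesSinkOrClash A → ∀ e → ExpectedQueries A sinkless e → fromℕ 2 ≤ e
  2≤expected solves e (ub , _) =
    ≤-resp-≗ {fromℕ 2 * fromℕ 1} {fromℕ 2} {fromℕ 2 * (fromℚ ½ * e)} {e}
      (λ _ → refl) (λ m → trans (sym (ℚ.*-assoc (+ 2 ℚ./ 1) ½ (seq e m))) (ℚ.*-identityˡ (seq e m)))
      (*-monoˡ-≤ {fromℕ 2} {fromℕ 1} {fromℚ ½ * e} (fromℕ-mono-≤ {0} {2} ℕ.z≤n)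
        (proj₂ (solves sinkless) (fromℚ ½ * e) below))
    where
    S = solvesAfter A sinkless
    T = λ k → fromℕ k * haltsAfter A sinkless k
    P = partialSum S
    twice-below : ∀ K → fromℕ 2 * P K ≤ e
    twice-below K = ≤-trans {fromℕ 2 * P K} {partialSum T K} {e}
      (≤-resp-≗ {partialSum (λ k → fromℕ 2 * S k) K} {fromℕ 2 * P K}
                {partialSum T K} {partialSum T K}
        (partialSum-*ˡ (fromℕ 2) S K) (λ _ → refl)
        (partialSum-mono {λ k → fromℕ 2 * S k} {T} 2*solves≤k*halts K))
      (ub K)
    below : ∀ K → P K ≤ fromℚ ½ * e
    below K =
      ≤-resp-≗ {fromℚ ½ * (fromℕ 2 * P K)} {P K} {fromℚ ½ * e} {fromℚ ½ * e}
        (λ m → trans (sym (ℚ.*-assoc ½ (+ 2 ℚ./ 1) (seq (P K) m))) (ℚ.*-identityˡ (seq (P K) m)))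
        (λ _ → refl)
        (*-monoˡ-≤ {fromℚ ½} {fromℕ 2 * P K} {e} (fromℚ-mono-≤ (ℚ.nonNegative⁻¹ ½))
          (twice-below K))

lemma28 : t̃[ 1 ]≈ fromℕ 2
lemma28 =
  ( queryBoth , queryBoth-solves
  , (λ _ → fromℕ 2) , queryBoth-expected
  -- All expectations equal 2, so any outmap shows leastness; `sinkless` is an arbitrary choice
  -- here.
  , (λ _ → ≤-refl {fromℕ 2}) , λ b ub → ub sinkless ) ,
  -- The worst case dominates the expectation on `sinkless`, which is at least 2.
  λ A solves b (e , expected , (ub , _)) →
    ≤-trans {fromℕ 2} {e sinkless} {b}
      (2≤expected A solves (e sinkless) (expected sinkless)) (ub sinkless)
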